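{- Let $\sigma$ be a propositional signature, and let all formulas be infinitary formulas over $\sigma$. For any set $\mathcal{H}$ of formulas (not required to be bounded) and any formulas $F$, $G$: (a) if $F$ is a theorem of the basic system, then $\mathcal{H}\cup\{F\}$ has the same stable models as $\mathcal{H}$; (b) if $F$ is equivalent to $G$ in the basic system, then $\mathcal{H}\cup\{F\}$ and $\mathcal{H}\cup\{G\}$ have the same stable models.
   Context: Formulas. A propositional signature $\sigma$ is a set of propositional atoms. Put $\mathcal{F}^\sigma_0=\sigma$, and let $\mathcal{F}^\sigma_{i+1}$ ($i\in\mathbb{N}$) be obtained from $\mathcal{F}^\sigma_i$ by adding the expressions $\mathcal{H}^\lor$ (disjunction) and $\mathcal{H}^\land$ (conjunction) for all subsets $\mathcal{H}\subseteq\mathcal{F}^\sigma_i$, of any cardinality, and the expressions $F\rightarrow G$ for all $F,G\in\mathcal{F}^\sigma_i$. The elements of $\bigcup_{i=0}^\infty\mathcal{F}^\sigma_i$ are the (infinitary) formulas over $\sigma$. A set of formulas is bounded if it is contained in some $\mathcal{F}^\sigma_i$; $\mathcal{H}^\land$ and $\mathcal{H}^\lor$ are formulas for bounded $\mathcal{H}$. Abbreviations: $\bot$ is $\emptyset^\lor$; $\neg F$ is $F\rightarrow\bot$; $F\land G$ is $\{F,G\}^\land$; $F\lor G$ is $\{F,G\}^\lor$; $F\leftrightarrow G$ is $(F\rightarrow G)\land(G\rightarrow F)$. Satisfaction. An interpretation is a subset $I\subseteq\sigma$. $I\models p$ iff $p\in I$ for $p\in\sigma$; $I\models\mathcal{H}^\land$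 iff $I\models F$ for every $F\in\mathcal{H}$; $I\models\mathcal{H}^\lor$ iff $I\models F$ for some $F\in\mathcal{H}$; $I\models F\rightarrow G$ iff $I\not\models F$ or $I\models G$. $I$ satisfies a set of formulas if it satisfies all its elements. Reduct and stable models. The reduct $F^I$ of $F$ with respect to $I$: for $p\in\sigma$, $p^I=p$ if $I\models p$ and $p^I=\bot$ otherwise; $(\mathcal{H}^\land)^I=\{G^I\mid G\in\mathcal{H}\}^\land$; $(\mathcal{H}^\lor)^I=\{G^I\mid G\in\mathcal{H}\}^\lor$; $(G\rightarrow H)^I=G^I\rightarrow H^I$ if $I\models G\rightarrow H$, and $\bot$ otherwise. For a set $\mathcal{H}$ of formulas, $\mathcal{H}^I=\{G^I\mid G\in\mathcal{H}\}$. $I$ is a stable model of a set $\mathcal{H}$ of formulas if $I$ is minimal with respect to set inclusion among the interpretations satisfying $\mathcal{H}^I$ (in particular $I$ satisfies $\mathcal{H}^I$). Basic system. A sequent is an expression $\Gamma\Rightarrow F$ with $F$ a formula and $\Gamma$ a finite set of formulas (written as a list, comma denoting union); $\Rightarrow F$ (empty $\Gamma$) is identified with $F$. Axioms: all sequents $F\Rightarrow F$. Inference rules ($\mathcal{H}$ ranges over bounded sets of formulas; $\Gamma,\Delta$ over finite sets of formulas): $(\land I)$ from $\Gamma\Rightarrow H$ for all $H\in\mathcal{H}$ infer $\Gamma\Rightarrow\mathcal{H}^\land$; $(\land E)$ from $\Gamma\Rightarrow\mathcal{H}^\land$ infer $\Gamma\Rightarrow H$ ($H\in\mathcal{H}$);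 $(\lor I)$ from $\Gamma\Rightarrow H$ ($H\in\mathcal{H}$) infer $\Gamma\Rightarrow\mathcal{H}^\lor$; $(\lor E)$ from $\Gamma\Rightarrow\mathcal{H}^\lor$ and $\Delta,H\Rightarrow F$ for all $H\in\mathcal{H}$ infer $\Gamma,\Delta\Rightarrow F$; $(\rightarrow I)$ from $\Gamma,F\Rightarrow G$ infer $\Gamma\Rightarrow F\rightarrow G$; $(\rightarrow E)$ from $\Gamma\Rightarrow F$ and $\Delta\Rightarrow F\rightarrow G$ infer $\Gamma,\Delta\Rightarrow G$; $(W)$ from $\Gamma\Rightarrow F$ infer $\Gamma,\Delta\Rightarrow F$. The set of theorems of the basic system is the smallest set of sequents containing the axioms and closed under the inference rules. Formulas $F$ and $G$ are equivalent in the basic system if $F\leftrightarrow G$ is a theorem of the basic system. -}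

module Defs where

open import Level using (Level; _⊔_; Lift; lift) renaming (suc to lsuc)
open import Axiom.ExcludedMiddle using (ExcludedMiddle)
open import Data.Bool.Base using (Bool; true; false; if_then_else_)
open import Data.Empty.Polymorphic using (⊥; ⊥-elim)
open import Data.List.Base using (List; []; _∷_; _++_)
import Data.List.Relation.Binary.Subset.Setoid as Subset
open import Data.Nat.Base using (ℕ; zero; suc; _≤′_; ≤′-reflexive; ≤′-step)
  renaming (_⊔_ to _⊔ℕ_; _≤_ to _≤ℕ_)
open import Data.Nat.Properties using (m≤m⊔n; m≤n⊔m; ≤⇒≤′)
open import Data.Product.Base using (∃; _×_; _,_)
open import Data.Sum.Base using (_⊎_)
open import Function.Bundles using (_⇔_)
open import Relation.Binary.Bundles using (Setoid)
open import Relation.Binary.PropositionalEquality.Core using (_≡_; refl; sym; trans)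
open import Relation.Nullary using (¬_; does)
open import Relation.Unary using (Pred; _∈_; _⊆_)

private
  variable
    ℓ ℓ′ : Level

-- Expressions of possibly transfinite rank; formulas are those of finite
-- rank (see Formula below).  A set of expressions under a connective is
-- given as the range of a family, so expressions are compared by _≈ᵉ_,
-- which makes families with the same range equal.
-- Classically every subset of 𝓕 i is, up to _≈ᵉ_, the range of a family
-- indexed by a type in Set ℓ: by induction on i, the elements of 𝓕 i are
-- coded by a type in Set ℓ, with Bool-valued functions coding subsets.
-- So restricting J to Set ℓ does not restrict the cardinality.
data Expr (σ : Set ℓ) : Set (lsuc ℓ) where
  atomᵉ   : σ → Expr σ
  ⋁ᵉ ⋀ᵉ   : (J : Set ℓ) → (J → Expr σ) → Expr σ
  _⊃ᵉ_    : Expr σ → Expr σ → Expr σ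

infixr 5 _⊃ᵉ_

module _ {ℓ} {σ : Set ℓ} where

  infix 4 _≈ᵉ_

  _≈ᵉ_ : Expr σ → Expr σ → Set ℓ
  atomᵉ p  ≈ᵉ atomᵉ q  = p ≡ q
  ⋁ᵉ J f   ≈ᵉ ⋁ᵉ K g   = (∀ j → ∃ λ k → f j ≈ᵉ g k) × (∀ k → ∃ λ j → f j ≈ᵉ g k)
  ⋀ᵉ J f   ≈ᵉ ⋀ᵉ K g   = (∀ j → ∃ λ k → f j ≈ᵉ g k) × (∀ k → ∃ λ j → f j ≈ᵉ g k)
  (F ⊃ᵉ G) ≈ᵉ (H ⊃ᵉ K) = (F ≈ᵉ H) × (G ≈ᵉ K)
  _        ≈ᵉ _        = ⊥

  ≈ᵉ-refl : ∀ E → E ≈ᵉ E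
  ≈ᵉ-refl (atomᵉ p) = refl
  ≈ᵉ-refl (⋁ᵉ J f)  = (λ j → j , ≈ᵉ-refl (f j)) , (λ j → j , ≈ᵉ-refl (f j))
  ≈ᵉ-refl (⋀ᵉ J f)  = (λ j → j , ≈ᵉ-refl (f j)) , (λ j → j , ≈ᵉ-refl (f j))
  ≈ᵉ-refl (F ⊃ᵉ G)  = ≈ᵉ-refl F , ≈ᵉ-refl G

  ≈ᵉ-sym : ∀ E E′ → E ≈ᵉ E′ → E′ ≈ᵉ E
  ≈ᵉ-sym (atomᵉ p) (atomᵉ q) e = sym e
  ≈ᵉ-sym (⋁ᵉ J f) (⋁ᵉ K g) (l , r) =
    (λ k → let j , e = r k in j , ≈ᵉ-sym (f j) (g k) e) ,
    (λ j → let k , e = l j in k , ≈ᵉ-sym (f j) (g k) e)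
  ≈ᵉ-sym (⋀ᵉ J f) (⋀ᵉ K g) (l , r) =
    (λ k → let j , e = r k in j , ≈ᵉ-sym (f j) (g k) e) ,
    (λ j → let k , e = l j in k , ≈ᵉ-sym (f j) (g k) e)
  ≈ᵉ-sym (F ⊃ᵉ G) (H ⊃ᵉ K) (d , e) = ≈ᵉ-sym F H d , ≈ᵉ-sym G K e

  ≈ᵉ-trans : ∀ E E′ E″ → E ≈ᵉ E′ → E′ ≈ᵉ E″ → E ≈ᵉ E″
  ≈ᵉ-trans (atomᵉ p) (atomᵉ q) (atomᵉ r) d e = trans d e
  ≈ᵉ-trans (⋁ᵉ J f) (⋁ᵉ K g) (⋁ᵉ L h) (l , r) (l′ , r′) =
    (λ j → let k , d = l j ; m , e = l′ k in m , ≈ᵉ-trans (f j) (g k) (h m) d e) ,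
    (λ m → let k , e = r′ m ; j , d = r k in j , ≈ᵉ-trans (f j) (g k) (h m) d e)
  ≈ᵉ-trans (⋀ᵉ J f) (⋀ᵉ K g) (⋀ᵉ L h) (l , r) (l′ , r′) =
    (λ j → let k , d = l j ; m , e = l′ k in m , ≈ᵉ-trans (f j) (g k) (h m) d e) ,
    (λ m → let k , e = r′ m ; j , d = r k in j , ≈ᵉ-trans (f j) (g k) (h m) d e)
  ≈ᵉ-trans (F ⊃ᵉ G) (F′ ⊃ᵉ G′) (F″ ⊃ᵉ G″) (d , d′) (e , e′) =
    ≈ᵉ-trans F F′ F″ d e , ≈ᵉ-trans G G′ G″ d′ e′

  data 𝓕 : ℕ → Expr σ → Set (lsuc ℓ) where
    atom : ∀ p → 𝓕 zero (atomᵉ p)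
    keep : ∀ {i E} → 𝓕 i E → 𝓕 (suc i) E
    disj : ∀ {i J f} → (∀ j → 𝓕 i (f j)) → 𝓕 (suc i) (⋁ᵉ J f)
    conj : ∀ {i J f} → (∀ j → 𝓕 i (f j)) → 𝓕 (suc i) (⋀ᵉ J f)
    impl : ∀ {i F G} → 𝓕 i F → 𝓕 i G → 𝓕 (suc i) (F ⊃ᵉ G)

  𝓕-mono′ : ∀ {i j E} → i ≤′ j → 𝓕 i E → 𝓕 j E
  𝓕-mono′ (≤′-reflexive refl) m = m
  𝓕-mono′ (≤′-step i≤j)       m = keep (𝓕-mono′ i≤j m)

  𝓕-mono : ∀ {i j E} → i ≤ℕ j → 𝓕 i E → 𝓕 j E
  𝓕-mono i≤j = 𝓕-mono′ (≤⇒≤′ i≤j)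

record Formula (σ : Set ℓ) : Set (lsuc ℓ) where
  constructor formula
  field
    expr   : Expr σ
    ranked : ∃ λ i → 𝓕 i expr

open Formula public

record BoundedSet (σ : Set ℓ) : Set (lsuc ℓ) where
  constructor boundedSet
  field
    Index   : Set ℓ
    elem    : Index → Formula σ
    bounded : ∃ λ i → ∀ j → 𝓕 i (expr (elem j))

open BoundedSet public

module _ {ℓ} {σ : Set ℓ} where

  infix 4 _≈_

  _≈_ : Formula σ → Formula σ → Set ℓ
  F ≈ G = expr F ≈ᵉ expr G

  atomᶠ : σ → Formula σ
  atomᶠ p = formula (atomᵉ p) (zero , atom p)

  ⋁ ⋀ : BoundedSet σ → Formula σ
  ⋁ (boundedSet J f (i , b)) = formula (⋁ᵉ J (λ j → expr (f j))) (suc i , disj b)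
  ⋀ (boundedSet J f (i , b)) = formula (⋀ᵉ J (λ j → expr (f j))) (suc i , conj b)

  infixr 5 _⊃_
  infixr 6 _∧_
  infix  4 _⟷_

  _⊃_ : Formula σ → Formula σ → Formula σ
  formula E (i , e) ⊃ formula E′ (j , e′) =
    formula (E ⊃ᵉ E′)
            (suc (i ⊔ℕ j) , impl (𝓕-mono (m≤m⊔n i j) e) (𝓕-mono (m≤n⊔m i j) e′))

  pair : Formula σ → Formula σ → BoundedSet σ
  pair F G = boundedSet (Lift ℓ Bool)
    (λ { (lift true) → F ; (lift false) → G })
    (let i , f = ranked F ; j , g = ranked G in
     i ⊔ℕ j , λ { (lift true)  → 𝓕-mono (m≤m⊔n i j) f
                ; (lift false) → 𝓕-mono (m≤n⊔m i j) g })

  _∧_ : Formula σ → Formula σ → Formula σ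
  F ∧ G = ⋀ (pair F G)

  _⟷_ : Formula σ → Formula σ → Formula σ
  F ⟷ G = (F ⊃ G) ∧ (G ⊃ F)

formulaSetoid : (σ : Set ℓ) → Setoid (lsuc ℓ) ℓ
formulaSetoid σ = record
  { Carrier       = Formula σ
  ; _≈_           = _≈_
  ; isEquivalence = record
    { refl  = λ {F} → ≈ᵉ-refl (expr F)
    ; sym   = λ {F} {G} → ≈ᵉ-sym (expr F) (expr G)
    ; trans = λ {F} {G} {H} → ≈ᵉ-trans (expr F) (expr G) (expr H)
    }
  }

Interpretation : Set ℓ → Set (lsuc ℓ)
Interpretation {ℓ} σ = Pred σ ℓ

module _ {ℓ} {σ : Set ℓ} where

  infix 4 _⊨ᵉ_ _⊨_ _⊨ˢ_

  _⊨ᵉ_ : Interpretation σ → Expr σ → Set ℓ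
  I ⊨ᵉ atomᵉ p  = p ∈ I
  I ⊨ᵉ ⋁ᵉ J f   = ∃ λ j → I ⊨ᵉ f j
  I ⊨ᵉ ⋀ᵉ J f   = ∀ j → I ⊨ᵉ f j
  I ⊨ᵉ (F ⊃ᵉ G) = (¬ (I ⊨ᵉ F)) ⊎ (I ⊨ᵉ G)

  _⊨_ : Interpretation σ → Formula σ → Set ℓ
  I ⊨ F = I ⊨ᵉ expr F

  -- An arbitrary, possibly unbounded, set of formulas is a predicate, which
  -- need not respect _≈_: it stands for its closure under _≈_.  The
  -- singleton {F} is F ≈_.
  _⊨ˢ_ : Interpretation σ → Pred (Formula σ) ℓ′ → Set (lsuc ℓ ⊔ ℓ′)
  I ⊨ˢ 𝓗 = ∀ F → F ∈ 𝓗 → I ⊨ F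

-- The reduct is defined by cases on satisfaction, which is decided by
-- excluded middle.
module _ {ℓ} (em : ExcludedMiddle ℓ) {σ : Set ℓ} where

  reductᵉ : Interpretation σ → Expr σ → Expr σ
  reductᵉ I (atomᵉ p) =
    if does (em {I ⊨ᵉ atomᵉ p}) then atomᵉ p else ⋁ᵉ ⊥ ⊥-elim
  reductᵉ I (⋁ᵉ J f)  = ⋁ᵉ J (λ j → reductᵉ I (f j))
  reductᵉ I (⋀ᵉ J f)  = ⋀ᵉ J (λ j → reductᵉ I (f j))
  reductᵉ I (F ⊃ᵉ G)  =
    if does (em {I ⊨ᵉ (F ⊃ᵉ G)}) then reductᵉ I F ⊃ᵉ reductᵉ I G else ⋁ᵉ ⊥ ⊥-elim

  -- The rank may grow by one, since an atom (rank 0) can become ∅^∨ (rank 1).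
  reduct-ranked : ∀ I {i E} → 𝓕 i E → 𝓕 (suc i) (reductᵉ I E)
  reduct-ranked I (atom p) with does (em {I ⊨ᵉ atomᵉ p})
  ... | true  = keep (atom p)
  ... | false = disj λ ()
  reduct-ranked I (keep e) = keep (reduct-ranked I e)
  reduct-ranked I (disj e) = disj λ j → reduct-ranked I (e j)
  reduct-ranked I (conj e) = conj λ j → reduct-ranked I (e j)
  reduct-ranked I (impl {F = F} {G = G} d e) with does (em {I ⊨ᵉ (F ⊃ᵉ G)})
  ... | true  = impl (reduct-ranked I d) (reduct-ranked I e)
  ... | false = disj λ ()

  reduct : Interpretation σ → Formula σ → Formula σ
  reduct I (formula E (i , e)) = formula (reductᵉ I E) (suc i , reduct-ranked I e)

  reductˢ : Interpretation σ → Pred (Formula σ) ℓ′ → Pred (Formula σ) (lsuc ℓ ⊔ ℓ′)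
  reductˢ I 𝓗 F = ∃ λ G → G ∈ 𝓗 × F ≈ reduct I G

  StableModel : Pred (Formula σ) ℓ′ → Interpretation σ → Set (lsuc ℓ ⊔ ℓ′)
  StableModel 𝓗 I =
    I ⊨ˢ reductˢ I 𝓗 ×
    (∀ (I′ : Interpretation σ) → I′ ⊨ˢ reductˢ I 𝓗 → I′ ⊆ I → I ⊆ I′)

  SameStableModels : ∀ {ℓ₁ ℓ₂} → Pred (Formula σ) ℓ₁ → Pred (Formula σ) ℓ₂ →
                     Set (lsuc ℓ ⊔ ℓ₁ ⊔ ℓ₂)
  SameStableModels 𝓗₁ 𝓗₂ = ∀ (I : Interpretation σ) → StableModel 𝓗₁ I ⇔ StableModel 𝓗₂ I

module _ {ℓ} {σ : Set ℓ} where

  open Subset (formulaSetoid σ) using () renaming (_⊆_ to _⊆ˡ_)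

  infix 3 _⇒_

  data _⇒_ : List (Formula σ) → Formula σ → Set (lsuc ℓ) where
    -- Antecedents are finite sets and formulas are taken modulo _≈_: this
    -- rule only passes between two representations of the same sequent.
    same : ∀ {Γ Δ F G} → Γ ⊆ˡ Δ → Δ ⊆ˡ Γ → F ≈ G → Γ ⇒ F → Δ ⇒ G
    ax   : ∀ {F} → F ∷ [] ⇒ F
    ⋀I   : ∀ {Γ} (𝓗 : BoundedSet σ) → (∀ j → Γ ⇒ elem 𝓗 j) → Γ ⇒ ⋀ 𝓗
    ⋀E   : ∀ {Γ} (𝓗 : BoundedSet σ) → Γ ⇒ ⋀ 𝓗 → ∀ j → Γ ⇒ elem 𝓗 j
    ⋁I   : ∀ {Γ} (𝓗 : BoundedSet σ) → ∀ j → Γ ⇒ elem 𝓗 j → Γ ⇒ ⋁ 𝓗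
    ⋁E   : ∀ {Γ Δ F} (𝓗 : BoundedSet σ) → Γ ⇒ ⋁ 𝓗 → (∀ j → elem 𝓗 j ∷ Δ ⇒ F) → Γ ++ Δ ⇒ F
    ⊃I   : ∀ {Γ F G} → F ∷ Γ ⇒ G → Γ ⇒ F ⊃ G
    ⊃E   : ∀ {Γ Δ F G} → Γ ⇒ F → Δ ⇒ F ⊃ G → Γ ++ Δ ⇒ G
    W    : ∀ {Γ Δ F} → Γ ⇒ F → Γ ++ Δ ⇒ F

  Theorem : Formula σ → Set (lsuc ℓ)
  Theorem F = [] ⇒ F

  Equivalent : Formula σ → Formula σ → Set (lsuc ℓ)
  Equivalent F G = Theorem (F ⟷ G)

{-# OPTIONS --safe #-}
-- For J ⊆ I, the condition J ⊨ F^I is the satisfaction of F in the logic of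
-- here-and-there at the pair (J, I), for which all rules of the basic system
-- are sound.  Hence F^I is valid if F is a theorem, and F^I and G^I have the
-- same models if F and G are equivalent.
module Submission where

open import Defs
open import Axiom.ExcludedMiddle using (ExcludedMiddle)
open import Data.Empty.Polymorphic using (⊥-elim)
open import Data.List.Base using ([]; _∷_)
open import Data.List.Relation.Unary.All as All using (All; []; _∷_)
open import Data.List.Relation.Unary.All.Properties using (++⁻ˡ; ++⁻ʳ)
open import Data.List.Relation.Binary.Subset.Setoid.Properties using (All-resp-⊇)
open import Data.Product.Base using (_×_; _,_; proj₁; proj₂)
open import Data.Sum.Base using (inj₁; inj₂)
open import Data.Bool.Base using (true; false)
open import Function.Base using (_∘_)
open import Function.Bundles using (mk⇔)
open import Level using (Level; lift)
open import Relation.Binary.PropositionalEquality.Core using (refl)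
open import Relation.Nullary using (yes; no; contradiction)
open import Relation.Unary using (Pred; _∪_)

private
  variable
    ℓ ℓ₁ ℓ₂ : Level

⊨ᵉ-resp-≈ᵉ : {σ : Set ℓ} (I : Interpretation σ) (E E′ : Expr σ) →
             E ≈ᵉ E′ → I ⊨ᵉ E → I ⊨ᵉ E′
⊨ᵉ-resp-≈ᵉ I (atomᵉ p) (atomᵉ q) refl        s       = s
⊨ᵉ-resp-≈ᵉ I (⋁ᵉ J f)  (⋁ᵉ K g)  (l , r)     (j , s) =
  let k , e = l j in k , ⊨ᵉ-resp-≈ᵉ I (f j) (g k) e s
⊨ᵉ-resp-≈ᵉ I (⋀ᵉ J f)  (⋀ᵉ K g)  (l , r)     s k     =
  let j , e = r k in ⊨ᵉ-resp-≈ᵉ I (f j) (g k) e (s j)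
⊨ᵉ-resp-≈ᵉ I (F ⊃ᵉ G)  (H ⊃ᵉ K)  (F≈H , G≈K) (inj₁ ¬F) =
  inj₁ (¬F ∘ ⊨ᵉ-resp-≈ᵉ I H F (≈ᵉ-sym F H F≈H))
⊨ᵉ-resp-≈ᵉ I (F ⊃ᵉ G)  (H ⊃ᵉ K)  (F≈H , G≈K) (inj₂ s)  =
  inj₂ (⊨ᵉ-resp-≈ᵉ I G K G≈K s)

module _ (em : ExcludedMiddle ℓ) {σ : Set ℓ} (I : Interpretation σ) where

  -- The reduct branches on satisfaction by `I`, which is invariant under `≈ᵉ`. Equal implications
  -- therefore take the same branch, and the mixed cases are contradictory.
  reductᵉ-cong : ∀ E E′ → E ≈ᵉ E′ → reductᵉ em I E ≈ᵉ reductᵉ em I E′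
  reductᵉ-cong (atomᵉ p) (atomᵉ q) refl    = ≈ᵉ-refl (reductᵉ em I (atomᵉ p))
  reductᵉ-cong (⋁ᵉ J f)  (⋁ᵉ K g)  (l , r) =
    (λ j → let k , e = l j in k , reductᵉ-cong (f j) (g k) e) ,
    (λ k → let j , e = r k in j , reductᵉ-cong (f j) (g k) e)
  reductᵉ-cong (⋀ᵉ J f)  (⋀ᵉ K g)  (l , r) =
    (λ j → let k , e = l j in k , reductᵉ-cong (f j) (g k) e) ,
    (λ k → let j , e = r k in j , reductᵉ-cong (f j) (g k) e)
  reductᵉ-cong (F ⊃ᵉ G)  (H ⊃ᵉ K)  e@(F≈H , G≈K)
    with em {I ⊨ᵉ (F ⊃ᵉ G)} | em {I ⊨ᵉ (H ⊃ᵉ K)}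
  ... | yes _ | yes _ = reductᵉ-cong F H F≈H , reductᵉ-cong G K G≈K
  ... | no _  | no _  = (λ ()) , (λ ())
  ... | yes s | no ¬s = contradiction (⊨ᵉ-resp-≈ᵉ I (F ⊃ᵉ G) (H ⊃ᵉ K) e s) ¬s
  ... | no ¬s | yes s = contradiction
    (⊨ᵉ-resp-≈ᵉ I (H ⊃ᵉ K) (F ⊃ᵉ G) (≈ᵉ-sym (F ⊃ᵉ G) (H ⊃ᵉ K) e) s) ¬s

  -- An atom or implication that fails at `I` is replaced by the empty disjunction, which no `J`
  -- satisfies. This is the passage from "here" to "there".
  reductᵉ-persistent : ∀ {J} E → J ⊨ᵉ reductᵉ em I E → I ⊨ᵉ E
  reductᵉ-persistent (⋁ᵉ J f) (j , s) = j , reductᵉ-persistent (f j) s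
  reductᵉ-persistent (⋀ᵉ J f) s j     = reductᵉ-persistent (f j) (s j)
  reductᵉ-persistent (atomᵉ p) s with em {I ⊨ᵉ atomᵉ p}
  ... | yes p∈I = p∈I
  ... | no _    = ⊥-elim (proj₁ s)
  reductᵉ-persistent (F ⊃ᵉ G) s with em {I ⊨ᵉ (F ⊃ᵉ G)}
  ... | yes t = t
  ... | no _  = ⊥-elim (proj₁ s)

  -- With persistence at `J = I`, this makes "there" classical: at `I` a formula and its reduct have
  -- the same truth value.
  ⊨ᵉ⇒⊨ᵉ-reductᵉ : ∀ E → I ⊨ᵉ E → I ⊨ᵉ reductᵉ em I E
  ⊨ᵉ⇒⊨ᵉ-reductᵉ (⋁ᵉ J f) (j , s) = j , ⊨ᵉ⇒⊨ᵉ-reductᵉ (f j) s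
  ⊨ᵉ⇒⊨ᵉ-reductᵉ (⋀ᵉ J f) s j     = ⊨ᵉ⇒⊨ᵉ-reductᵉ (f j) (s j)
  ⊨ᵉ⇒⊨ᵉ-reductᵉ (atomᵉ p) s with em {I ⊨ᵉ atomᵉ p}
  ... | yes p∈I = p∈I
  ... | no p∉I  = contradiction s p∉I
  ⊨ᵉ⇒⊨ᵉ-reductᵉ (F ⊃ᵉ G) s with em {I ⊨ᵉ (F ⊃ᵉ G)}
  ... | no ¬s = contradiction s ¬s
  ⊨ᵉ⇒⊨ᵉ-reductᵉ (F ⊃ᵉ G) (inj₁ ¬F) | yes _ = inj₁ (¬F ∘ reductᵉ-persistent F)
  ⊨ᵉ⇒⊨ᵉ-reductᵉ (F ⊃ᵉ G) (inj₂ s)  | yes _ = inj₂ (⊨ᵉ⇒⊨ᵉ-reductᵉ G s)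

  module _ {J : Interpretation σ} where

    ⊨-reduct-resp : ∀ {F G} → F ≈ G → J ⊨ reduct em I F → J ⊨ reduct em I G
    ⊨-reduct-resp {F} {G} F≈G =
      ⊨ᵉ-resp-≈ᵉ J _ _ (reductᵉ-cong (expr F) (expr G) F≈G)

    ⊃-reduct⁻ : ∀ {F G} → J ⊨ reduct em I (F ⊃ G) →
                J ⊨ reduct em I F → J ⊨ reduct em I G
    ⊃-reduct⁻ {F} {G} s t with em {I ⊨ (F ⊃ G)}
    ⊃-reduct⁻ (inj₁ ¬F) t | yes _ = contradiction t ¬F
    ⊃-reduct⁻ (inj₂ s)  _ | yes _ = s
    ⊃-reduct⁻ s         _ | no _  = ⊥-elim (proj₁ s)

  -- The implication is also needed at I itself, because (F ⊃ G)^I is ⊥ unless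
  -- I ⊨ F ⊃ G.
  ⊃-reduct⁺ : ∀ {J F G} →
              (I ⊨ reduct em I F → I ⊨ reduct em I G) →
              (J ⊨ reduct em I F → J ⊨ reduct em I G) →
              J ⊨ reduct em I (F ⊃ G)
  ⊃-reduct⁺ {J} {F} {G} atI atJ with em {I ⊨ (F ⊃ G)}
  ... | yes _ with em {J ⊨ reduct em I F}
  ...   | yes s = inj₂ (atJ s)
  ...   | no ¬s = inj₁ ¬s
  ⊃-reduct⁺ {J} {F} {G} atI atJ | no ¬t with em {I ⊨ F}
  -- Since `I` does not distinguish a formula from its reduct, `atI` carries `F` to `G` at `I`, so
  -- the implication holds there after all.
  ...   | yes s = contradiction
    (inj₂ (reductᵉ-persistent (expr G) (atI (⊨ᵉ⇒⊨ᵉ-reductᵉ (expr F) s)))) ¬t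
  ...   | no ¬s = contradiction (inj₁ ¬s) ¬t

  -- Induction on the derivation. `J` is quantified after it because the case `⊃I` uses the
  -- induction hypothesis at `I` as well as at `J`.
  ⇒-sound : ∀ {Γ F} → Γ ⇒ F → ∀ {J} →
            All (λ G → J ⊨ reduct em I G) Γ → J ⊨ reduct em I F
  ⇒-sound (same {F = F} {G} Γ⊆Δ _ F≈G d) γ =
    ⊨-reduct-resp {F = F} {G} F≈G (⇒-sound d (All-resp-⊇ (formulaSetoid σ)
      (λ {H} {K} → ⊨-reduct-resp {F = H} {K}) (λ {H} → Γ⊆Δ {H}) γ))
  ⇒-sound ax           (s ∷ []) = s
  ⇒-sound (⋀I 𝓗 d)     γ j      = ⇒-sound (d j) γ
  ⇒-sound (⋀E 𝓗 d j)   γ        = ⇒-sound d γ j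
  ⇒-sound (⋁I 𝓗 j d)   γ        = j , ⇒-sound d γ
  ⇒-sound (⋁E {Γ} 𝓗 d e) γ      =
    let j , s = ⇒-sound d (++⁻ˡ Γ γ) in ⇒-sound (e j) (s ∷ ++⁻ʳ Γ γ)
  ⇒-sound (⊃I {F = F} {G} d) γ  = ⊃-reduct⁺ {F = F} {G}
    -- The antecedents move from `J` to `I`: persistence gives each `H` at `I`, and there `H` yields
    -- its reduct.
    (λ s → ⇒-sound d (s ∷ All.map
      (λ {H} → ⊨ᵉ⇒⊨ᵉ-reductᵉ (expr H) ∘ reductᵉ-persistent (expr H)) γ))
    (λ s → ⇒-sound d (s ∷ γ))
  ⇒-sound (⊃E {Γ} {F = F} {G} d e) γ =
    ⊃-reduct⁻ {F = F} {G} (⇒-sound e (++⁻ʳ Γ γ)) (⇒-sound d (++⁻ˡ Γ γ))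
  ⇒-sound (W {Γ} d)    γ        = ⇒-sound d (++⁻ˡ Γ γ)

  ⊨ˢ-reductˢ-∪⁻ : ∀ {𝓗 : Pred (Formula σ) ℓ₁} {J} F →
                  J ⊨ˢ reductˢ em I (𝓗 ∪ (F ≈_)) →
                  J ⊨ˢ reductˢ em I 𝓗 × J ⊨ reduct em I F
  ⊨ˢ-reductˢ-∪⁻ F s =
    (λ { K (G , G∈𝓗 , e) → s K (G , inj₁ G∈𝓗 , e) }) ,
    s (reduct em I F) (F , inj₂ (≈ᵉ-refl (expr F)) , ≈ᵉ-refl (reductᵉ em I (expr F)))

  ⊨ˢ-reductˢ-∪⁺ : ∀ {𝓗 : Pred (Formula σ) ℓ₁} {J} F →
                  J ⊨ˢ reductˢ em I 𝓗 → J ⊨ reduct em I F →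
                  J ⊨ˢ reductˢ em I (𝓗 ∪ (F ≈_))
  ⊨ˢ-reductˢ-∪⁺ F s t K (G , inj₁ G∈𝓗 , e) = s K (G , G∈𝓗 , e)
  -- `G` may be any representative of the class of `F`, so the reduct of `F` is first exchanged for
  -- that of `G`, then for `K`.
  ⊨ˢ-reductˢ-∪⁺ {J = J} F s t K (G , inj₂ F≈G , e) =
    ⊨ᵉ-resp-≈ᵉ J _ _ (≈ᵉ-sym (expr K) _ e) (⊨-reduct-resp {F = F} {G} F≈G t)

module _ (em : ExcludedMiddle ℓ) {σ : Set ℓ} where

  -- Stability of `I` depends only on which interpretations satisfy the reduct. Minimality is
  -- contravariant: a competitor for one set is first turned into a competitor for the other.
  sameStableModels : {𝓗₁ : Pred (Formula σ) ℓ₁} {𝓗₂ : Pred (Formula σ) ℓ₂} →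
    (∀ I {J} → J ⊨ˢ reductˢ em I 𝓗₁ → J ⊨ˢ reductˢ em I 𝓗₂) →
    (∀ I {J} → J ⊨ˢ reductˢ em I 𝓗₂ → J ⊨ˢ reductˢ em I 𝓗₁) →
    SameStableModels em 𝓗₁ 𝓗₂
  sameStableModels to from I = mk⇔
    (λ { (s , minimal) → to I s , λ J t → minimal J (from I t) })
    (λ { (s , minimal) → from I s , λ J t → minimal J (to I t) })

mainTheorem1 : ∀ {ℓ ℓ′} (em : ExcludedMiddle ℓ) (σ : Set ℓ)
    (𝓗 : Pred (Formula σ) ℓ′) (F G : Formula σ) →
    (Theorem F → SameStableModels em (𝓗 ∪ (F ≈_)) 𝓗) ×
    (Equivalent F G → SameStableModels em (𝓗 ∪ (F ≈_)) (𝓗 ∪ (G ≈_)))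
mainTheorem1 em σ 𝓗 F G =
  (λ d → sameStableModels em
    (λ I s → proj₁ (⊨ˢ-reductˢ-∪⁻ em I F s))
    (λ I s → ⊨ˢ-reductˢ-∪⁺ em I F s (⇒-sound em I d []))) ,
  (λ d → sameStableModels em
    (λ I s → let h , f = ⊨ˢ-reductˢ-∪⁻ em I F s in
      ⊨ˢ-reductˢ-∪⁺ em I G h
        -- `lift true` selects the conjunct `F ⊃ G` of the equivalence; `lift false` below selects
        -- `G ⊃ F`.
        (⊃-reduct⁻ em I {F = F} {G} (⇒-sound em I d [] (lift true)) f))
    (λ I s → let h , g = ⊨ˢ-reductˢ-∪⁻ em I G s in
      ⊨ˢ-reductˢ-∪⁺ em I F h
        (⊃-reduct⁻ em I {F = G} {F} (⇒-sound em I d [] (lift false)) g)))
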